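{- As formal power series in $t$, $$\sum_{n\ge0}R_{1,n}t^n=\frac{\sum_{j=0}^{r}(-1)^j d_j t^j}{\sum_{j=0}^{r+1}(-1)^j c_j t^j},\qquad d_j=\sum_{i=0}^{j}(-1)^{j-i}c_i\,R_{1,j-i}.$$
   Context: Fix $r\ge1$, $I_r=\{1,\dots,r\}$. Let $R_{1,0},\dots,R_{r,0},R_{1,1},\dots,R_{r,1}$ be algebraically independent indeterminates over $\mathbb Q$ and $(R_{\alpha,n})_{0\le\alpha\le r+1,n\in\mathbb Z}$ the $A_r$ $Q$-system: the unique family of nonzero elements of $\mathbb Q(R_{1,0},\dots,R_{r,1})$ with these initial values, $R_{0,n}=R_{r+1,n}=1$, and $R_{\alpha,n+1}R_{\alpha,n-1}=R_{\alpha,n}^2+R_{\alpha+1,n}R_{\alpha-1,n}$ ($\alpha\in I_r$, $n\in\mathbb Z$). For $k\in\{0,\dots,r+1\}$, $c_k$ is the determinant of the matrix obtained from $(R_{1,n+i+j-r-3})_{1\le i,j\le r+2}$ by deleting row $r+2$ and column $r+2-k$ (independent of $n$; $c_0=c_{r+1}=1$). -}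

module Defs where

open import Level using (_⊔_)
open import Algebra.Apartness.Bundles using (HeytingField; HeytingCommutativeRing)
open import Algebra.Bundles using (CommutativeRing)
open import Algebra.Morphism.Structures using (IsRingHomomorphism)
import Algebra.Properties.CommutativeMonoid.Sum as CommutativeMonoidSum
import Algebra.Properties.Semiring.Exp as SemiringExp
open import Data.Bool.Base using (if_then_else_)
open import Data.Fin.Base using (Fin; zero; suc; toℕ; fromℕ; inject; inject₁; opposite; punchIn)
open import Data.Integer.Base as ℤ using (ℤ; +_)
open import Data.List.Base as List using (List; []; _∷_)
open import Data.Nat.Base as ℕ using (ℕ; zero; suc; _∸_)
import Data.Nat.Properties as ℕ
open import Data.Product.Base using (∃-syntax; _×_; _,_)
open import Data.Rational.Base as ℚ using (ℚ; 0ℚ)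
open import Data.Vec.Base as Vec using (Vec)
import Data.Vec.Properties as Vec
open import Data.Vec.Functional using (Vector; _++_)
open import Relation.Binary.PropositionalEquality.Core using (_≡_)
open import Relation.Nullary.Decidable.Core using (does)

-- A finite formal sum of terms q · x₁^e₁ ⋯ xₙ^eₙ.  An exponent vector may occur
-- in several terms, so a polynomial is determined by its coefficients.
Polynomial : ℕ → Set
Polynomial n = List (ℚ × Vec ℕ n)

coeff : ∀ {n} → Polynomial n → Vec ℕ n → ℚ
coeff []            m = 0ℚ
coeff ((q , e) ∷ p) m = if does (Vec.≡-dec ℕ._≟_ e m) then q ℚ.+ coeff p m else coeff p m

module OverRing {c ℓ} (A : CommutativeRing c ℓ) where

  open CommutativeRing A hiding (zero)
  open CommutativeMonoidSum +-commutativeMonoid using (sum)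
  open CommutativeMonoidSum *-commutativeMonoid using () renaming (sum to product)
  open SemiringExp semiring using (_^_)

  sgn : ℕ → Carrier
  sgn k = (- 1#) ^ k

  Matrix : ℕ → Set c
  Matrix n = Fin n → Fin n → Carrier

  deleteRowCol : ∀ {n} → Matrix (suc n) → Fin (suc n) → Fin (suc n) → Matrix n
  deleteRowCol M i j a b = M (punchIn i a) (punchIn j b)

  -- Laplace expansion along the first row.
  det : ∀ {n} → Matrix n → Carrier
  det {zero}  M = 1#
  det {suc n} M = sum λ j → sgn (toℕ j) * (M zero j * det (deleteRowCol M zero j))

  infix  4 _≋_ _≋_÷_
  infixl 7 _⊛_

  PowerSeries : Set c
  PowerSeries = ℕ → Carrier

  _≋_ : PowerSeries → PowerSeries → Set ℓ
  f ≋ g = ∀ n → f n ≈ g n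

  _⊛_ : PowerSeries → PowerSeries → PowerSeries
  (f ⊛ g) n = sum {suc n} λ i → f (toℕ i) * g (n ∸ toℕ i)

  -- ∑_{j < m} a j · t^j
  polySeries : ∀ {m} → Vector Carrier m → PowerSeries
  polySeries {zero}  a n       = 0#
  polySeries {suc m} a zero    = a zero
  polySeries {suc m} a (suc n) = polySeries (λ j → a (suc j)) n

  oneSeries : PowerSeries
  oneSeries = polySeries {1} λ _ → 1#

  -- F = P / Q in A[[t]]: Q is a unit of A[[t]] and F = P · Q⁻¹.
  _≋_÷_ : PowerSeries → PowerSeries → PowerSeries → Set (c ⊔ ℓ)
  F ≋ P ÷ Q = ∃[ Q⁻¹ ] (Q ⊛ Q⁻¹ ≋ oneSeries) × (F ≋ P ⊛ Q⁻¹)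

  evalMonomial : ∀ {n} → Vector Carrier n → Vec ℕ n → Carrier
  evalMonomial x e = product λ i → x i ^ Vec.lookup e i

  eval : ∀ {n} → (ℚ → Carrier) → Vector Carrier n → Polynomial n → Carrier
  eval ι x []            = 0#
  eval ι x ((q , e) ∷ p) = ι q * evalMonomial x e + eval ι x p

module OverField {c ℓ₁ ℓ₂} (K : HeytingField c ℓ₁ ℓ₂) where

  commutativeRing : CommutativeRing c ℓ₁
  commutativeRing =
    HeytingCommutativeRing.commutativeRing (HeytingField.heytingCommutativeRing K)

  open CommutativeRing commutativeRing public
    using (Carrier; _≈_; _≉_; _+_; _*_; 0#; 1#; rawRing; +-commutativeMonoid)
  open CommutativeMonoidSum +-commutativeMonoid using (sum)
  open OverRing commutativeRing public

  -- K = ℚ(x₁,…,xₙ) with x₁,…,xₙ algebraically independent over ℚ, where ℚ is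
  -- embedded in K by ι.
  record IsRationalFunctionField {n} (ι : ℚ → Carrier) (x : Vector Carrier n)
         : Set (c ⊔ ℓ₁) where
    field
      ι-isRingHomomorphism     : IsRingHomomorphism ℚ.+-*-rawRing rawRing ι
      algebraicallyIndependent : ∀ p → eval ι x p ≈ 0# → ∀ m → coeff p m ≡ 0ℚ
      generates                : ∀ z → ∃[ p ] ∃[ q ] (eval ι x q ≉ 0#) × (z * eval ι x q ≈ eval ι x p)

  -- The index α ∈ {0,…,r+1} is an element of Fin (2 + r).  For i : Fin r and
  -- α = 1 + toℕ i ∈ I_r, the indices α - 1, α, α + 1 are
  -- inject₁ (inject₁ i), suc (inject₁ i), suc (suc i).
  module _ (r : ℕ) (R : Fin (2 ℕ.+ r) → ℤ → Carrier) where

    -- R_{1,0}, …, R_{r,0}, R_{1,1}, …, R_{r,1}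
    initialValues : Vector Carrier (r ℕ.+ r)
    initialValues = (λ i → R (suc (inject₁ i)) (+ 0)) ++ (λ i → R (suc (inject₁ i)) (+ 1))

    record IsQSystem : Set (c ⊔ ℓ₁) where
      field
        nonzero       : ∀ α n → R α n ≉ 0#
        lowerBoundary : ∀ n → R zero n ≈ 1#
        upperBoundary : ∀ n → R (fromℕ (suc r)) n ≈ 1#
        relation      : ∀ (i : Fin r) n →
          R (suc (inject₁ i)) (n ℤ.+ + 1) * R (suc (inject₁ i)) (n ℤ.- + 1)
            ≈ R (suc (inject₁ i)) n * R (suc (inject₁ i)) n
              + R (suc (suc i)) n * R (inject₁ (inject₁ i)) n

    R₁ : ℤ → Carrier
    R₁ = R (suc zero)

    -- (R_{1,n+i+j-r-3})_{1≤i,j≤r+2}; the 1-based row index is suc (toℕ i).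
    hankel : ℤ → Matrix (2 ℕ.+ r)
    hankel n i j = R₁ (n ℤ.+ + suc (toℕ i) ℤ.+ + suc (toℕ j) ℤ.- + r ℤ.- + 3)

    -- c_k computed at the base point n.  The last index is row r+2, and
    -- opposite k, i.e. r + 1 - k counted from 0, is column r+2-k.
    conserved : ℤ → Fin (2 ℕ.+ r) → Carrier
    conserved n k = det (deleteRowCol (hankel n) (fromℕ (suc r)) (opposite k))

    -- d_j for 0 ≤ j ≤ r; inject {i = suc j} includes {0,…,j} into {0,…,r+1}.
    numeratorCoeff : ℤ → Fin (suc r) → Carrier
    numeratorCoeff n j = sum {suc (toℕ j)} λ i →
      sgn (toℕ j ∸ toℕ i) * conserved n (inject {i = suc j} i) * R₁ (+ (toℕ j ∸ toℕ i))

    generatingSeries : PowerSeries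
    generatingSeries m = R₁ (+ m)

    numerator denominator : ℤ → PowerSeries
    numerator   n = polySeries λ (j : Fin (suc r)) → sgn (toℕ j) * numeratorCoeff n j
    denominator n = polySeries λ (j : Fin (2 ℕ.+ r)) → sgn (toℕ j) * conserved n j

{-# OPTIONS --safe #-}

-- Write W_{m,s} for the m × m Hankel determinant of the sequence R_{1,n} whose
-- top left entry is R_{1,s}.  The Desnanot–Jacobi identity shows that these
-- determinants satisfy the Q-system recursion, so R_{α,n} = W_{α,n+1-α}.  The upper
-- boundary condition then says W_{r+1,s} = 1 for all s, and one more condensation
-- gives W_{r+2,s} = 0.  Hence the signed maximal minors of the first r+1 rows, which
-- are (-1)^j c_j up to order and a common sign, annihilate all r+2 rows of the Hankel
-- matrix.  Windows at s and s+1 share r+1 rows, whose kernel is a line on which the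
-- vectors are normalised by c_0 = 1, so the c_j do not depend on the window and R_{1,n}
-- satisfies the linear recurrence with coefficients (-1)^j c_j.  That recurrence is the
-- vanishing of the coefficients of t^m, m > r, in the product of the denominator with
-- the generating series.
module Submission where

open import Defs
open import Algebra.Apartness.Bundles using (HeytingField)
open import Algebra.Bundles using (CommutativeRing)
import Algebra.Properties.CommutativeMonoid.Sum as CommutativeMonoidSum
import Algebra.Properties.Ring as RingProperties
import Algebra.Properties.Semiring.Exp as SemiringExp
import Algebra.Properties.Semiring.Sum as SemiringSum
import Algebra.Solver.Ring.NaturalCoefficients.Default as SemiringSolver
open import Data.Fin.Base using (Fin; zero; suc; toℕ; fromℕ; fromℕ<; inject; inject₁; lift; opposite; punchIn)
open import Data.Fin.Permutation using (reverse)
open import Data.Fin.Properties using (opposite-prop; toℕ<n; toℕ-fromℕ; toℕ-fromℕ<; toℕ-inject; toℕ-inject₁)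
open import Data.Fin.Relation.Unary.Top using (view; ‵fromℕ; ‵inject₁)
open import Data.Integer.Base as ℤ using (ℤ; +_; -[1+_])
import Data.Integer.Properties as ℤ
open import Data.Integer.Solver using (module +-*-Solver)
open import Data.Nat.Base as ℕ using (ℕ; suc; _∸_; _≤_; s≤s; z≤n)
import Data.Nat.Properties as ℕ
open import Data.Product.Base using (_,_; proj₁)
open import Data.Rational.Base using (ℚ)
open import Data.Vec.Functional using (Vector; _∷_; tail)
open import Function.Base using (_∘_)
open import Relation.Binary.PropositionalEquality.Core as ≡ using (_≡_; _≗_)
import Relation.Binary.Reasoning.Setoid as SetoidReasoning
open import Relation.Nullary.Decidable.Core using (yes; no)

punchIn-fromℕ : ∀ {n} (i : Fin n) → punchIn (fromℕ n) i ≡ inject₁ i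
punchIn-fromℕ zero    = ≡.refl
punchIn-fromℕ (suc i) = ≡.cong suc (punchIn-fromℕ i)

module Sum {c ℓ} (A : CommutativeRing c ℓ) where

  open CommutativeRing A hiding (zero)
  open CommutativeMonoidSum +-commutativeMonoid using (sum; sum-cong-≋; sum-replicate-zero)

  sum-zero : ∀ {n} {t : Vector Carrier n} → (∀ i → t i ≈ 0#) → sum t ≈ 0#
  sum-zero {n} t≈0 = trans (sum-cong-≋ t≈0) (sum-replicate-zero n)

-- Determinants by Laplace expansion: alternation, Cramer's rule and condensation.

module Determinant {c ℓ} (A : CommutativeRing c ℓ) where

  open CommutativeRing A hiding (zero)
  open CommutativeMonoidSum +-commutativeMonoid
    using (sum; sum-cong-≋; sum-remove; sum-init-last; ∑-distrib-+; ∑-comm)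
  open RingProperties ring using (-1*x≈-x; -‿involutive; +-inverseˡ-unique)
  open SemiringExp semiring using (^-homo-*)
  open SemiringSum semiring using (*-distribˡ-sum; *-distribʳ-sum)
  open SemiringSolver commutativeSemiring using (solve; _:=_; _:+_; _:*_)
  open SetoidReasoning setoid
  open OverRing A
  open Sum A

  -1*-1≈1 : - 1# * - 1# ≈ 1#
  -1*-1≈1 = trans (-1*x≈-x (- 1#)) (-‿involutive 1#)

  sgn*sgn≈1 : ∀ k → sgn k * sgn k ≈ 1#
  sgn*sgn≈1 ℕ.zero    = *-identityˡ 1#
  sgn*sgn≈1 (ℕ.suc k) = begin
    (- 1# * sgn k) * (- 1# * sgn k)  ≈⟨ solve 2 (λ e s → (e :* s) :* (e :* s) := (e :* e) :* (s :* s)) refl (- 1#) (sgn k) ⟩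
    (- 1# * - 1#) * (sgn k * sgn k)  ≈⟨ *-cong -1*-1≈1 (sgn*sgn≈1 k) ⟩
    1# * 1#                          ≈⟨ *-identityˡ 1# ⟩
    1#                               ∎

  sgn*x≈0⇒x≈0 : ∀ k {x} → sgn k * x ≈ 0# → x ≈ 0#
  sgn*x≈0⇒x≈0 k {x} eq = begin
    x                    ≈⟨ *-identityˡ x ⟨
    1# * x               ≈⟨ *-congʳ (sgn*sgn≈1 k) ⟨
    (sgn k * sgn k) * x  ≈⟨ *-assoc (sgn k) (sgn k) x ⟩
    sgn k * (sgn k * x)  ≈⟨ *-congˡ eq ⟩
    sgn k * 0#           ≈⟨ zeroʳ (sgn k) ⟩
    0#                   ∎

  sgn*sgn[∸]≈sgn : ∀ {i j} → i ℕ.≤ j → sgn j * sgn (j ∸ i) ≈ sgn i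
  sgn*sgn[∸]≈sgn {i} {j} i≤j = begin
    sgn j * d                  ≡⟨ ≡.cong (λ k → sgn k * d) (ℕ.m+[n∸m]≡n i≤j) ⟨
    sgn (i ℕ.+ (j ∸ i)) * d    ≈⟨ *-congʳ (^-homo-* (- 1#) i (j ∸ i)) ⟩
    sgn i * d * d              ≈⟨ *-assoc (sgn i) d d ⟩
    sgn i * (d * d)            ≈⟨ *-congˡ (sgn*sgn≈1 (j ∸ i)) ⟩
    sgn i * 1#                 ≈⟨ *-identityʳ (sgn i) ⟩
    sgn i                      ∎
    where
    d : Carrier
    d = sgn (j ∸ i)

  det-cong : ∀ {n} {M N : Matrix n} → (∀ i j → M i j ≈ N i j) → det M ≈ det N
  det-cong {ℕ.zero}  M≈N = refl
  det-cong {ℕ.suc n} M≈N = sum-cong-≋ λ j →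
    *-congˡ {sgn (toℕ j)} (*-cong (M≈N zero j) (det-cong λ a b → M≈N (suc a) (punchIn j b)))

  det-sum-firstRow : ∀ {m n} (w : Vector Carrier m) (a : Fin m → Vector Carrier (suc n))
                     (B : Vector (Vector Carrier (suc n)) n) →
                     det ((λ j → sum λ i → w i * a i j) ∷ B) ≈ sum λ i → w i * det (a i ∷ B)
  det-sum-firstRow w a B = begin
    sum (λ j → s j * (sum (λ i → w i * a i j) * C j))
      ≈⟨ sum-cong-≋ (λ j → trans (*-congˡ {s j} (*-distribʳ-sum (C j) λ i → w i * a i j))
                                 (*-distribˡ-sum (s j) λ i → w i * a i j * C j)) ⟩
    sum (λ j → sum λ i → s j * (w i * a i j * C j))
      ≈⟨ ∑-comm (λ j i → s j * (w i * a i j * C j)) ⟩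
    sum (λ i → sum λ j → s j * (w i * a i j * C j))
      ≈⟨ sum-cong-≋ (λ i → trans (sum-cong-≋ λ j → rearrange (s j) (w i) (a i j) (C j))
                                 (sym (*-distribˡ-sum (w i) λ j → s j * (a i j * C j)))) ⟩
    sum (λ i → w i * det (a i ∷ B)) ∎
    where
    s : Fin _ → Carrier
    s j = sgn (toℕ j)
    C : Fin _ → Carrier
    C j = det λ x y → B x (punchIn j y)
    rearrange : ∀ p q x y → p * (q * x * y) ≈ q * (p * (x * y))
    rearrange = solve 4 (λ p q x y → p :* (q :* x :* y) := q :* (p :* (x :* y))) refl

  -- Expanding a determinant along its first two rows gives such a sum.  The terms
  -- that pick the same two columns in either order cancel.
  pairSum≈0 : ∀ {n} (h : Fin (2 ℕ.+ n) → Fin (2 ℕ.+ n) → Carrier) → (∀ i j → h i j ≈ h j i) →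
              (G : (Fin n → Fin (2 ℕ.+ n)) → Carrier) → (∀ {σ τ} → σ ≗ τ → G σ ≈ G τ) →
              (sum λ j → sum λ k → sgn (toℕ j) * (sgn (toℕ k) *
                (h j (punchIn j k) * G (punchIn j ∘ punchIn k)))) ≈ 0#
  pairSum≈0 {n} h h-sym G G-ext = begin
    -- Column zero is picked first in `T zero` and second in the terms `T (suc j) zero`; these two
    -- families cancel pairwise. The pairs avoiding column zero make up `rest`.
    sum (T zero) + sum (λ j → T (suc j) zero + rest j)
      ≈⟨ +-congˡ (∑-distrib-+ (λ j → T (suc j) zero) rest) ⟩
    sum (T zero) + (sum (λ j → T (suc j) zero) + sum rest)
      ≈⟨ +-assoc (sum (T zero)) (sum λ j → T (suc j) zero) (sum rest) ⟨
    (sum (T zero) + sum (λ j → T (suc j) zero)) + sum rest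
      ≈⟨ +-cong (sym (∑-distrib-+ (T zero) λ j → T (suc j) zero)) (rest≈0 h h-sym G G-ext) ⟩
    sum (λ j → T zero j + T (suc j) zero) + 0#
      ≈⟨ +-identityʳ _ ⟩
    sum (λ j → T zero j + T (suc j) zero)
      ≈⟨ sum-zero cancel ⟩
    0# ∎
    where
    T : Fin (2 ℕ.+ n) → Fin (1 ℕ.+ n) → Carrier
    T j k = sgn (toℕ j) * (sgn (toℕ k) * (h j (punchIn j k) * G (punchIn j ∘ punchIn k)))

    rest : Fin (1 ℕ.+ n) → Carrier
    rest j = sum λ k → T (suc j) (suc k)

    cancel : ∀ j → T zero j + T (suc j) zero ≈ 0#
    cancel j = begin
      1# * (s * (h zero (suc j) * g)) + (- 1# * s) * (1# * (h (suc j) zero * g))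
        ≈⟨ +-congˡ (*-congˡ {x = - 1# * s} (*-congˡ (*-congʳ {x = g} (h-sym (suc j) zero)))) ⟩
      1# * (s * (h zero (suc j) * g)) + (- 1# * s) * (1# * (h zero (suc j) * g))
        ≈⟨ solve 5 (λ u e s h g → u :* (s :* (h :* g)) :+ (e :* s) :* (u :* (h :* g))
                                 := u :* (s :* (h :* g)) :+ e :* (u :* (s :* (h :* g))))
             refl 1# (- 1#) s (h zero (suc j)) g ⟩
      y + - 1# * y  ≈⟨ +-congˡ (-1*x≈-x y) ⟩
      y - y         ≈⟨ -‿inverseʳ y ⟩
      0#            ∎
      where
      s g y : Carrier
      s = sgn (toℕ j)
      g = G (suc ∘ punchIn j)
      y = 1# * (s * (h zero (suc j) * g))

    -- Quantified afresh so that it can recurse with `pairSum≈0` at a smaller size. Pairs avoiding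
    -- column zero form a sum of the same kind on the remaining columns: both signs change, so their
    -- product does not, and column zero stays first among the complementary columns, whence
    -- `lift 1`. That description of the columns holds only pointwise, which is where `G-ext`
    -- enters.
    rest≈0 : ∀ {n} (h : Fin (2 ℕ.+ n) → Fin (2 ℕ.+ n) → Carrier) → (∀ i j → h i j ≈ h j i) →
             (G : (Fin n → Fin (2 ℕ.+ n)) → Carrier) → (∀ {σ τ} → σ ≗ τ → G σ ≈ G τ) →
             (sum λ j → sum λ k → sgn (toℕ (suc j)) * (sgn (toℕ (suc k)) *
               (h (suc j) (punchIn (suc j) (suc k)) * G (punchIn (suc j) ∘ punchIn (suc k))))) ≈ 0#
    rest≈0 {ℕ.zero}  h h-sym G G-ext = sum-zero λ (j : Fin 1) → refl
    rest≈0 {ℕ.suc n} h h-sym G G-ext = begin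
      sum (λ j → sum λ k → (- 1# * sgn (toℕ j)) * ((- 1# * sgn (toℕ k)) *
        (h (suc j) (suc (punchIn j k)) * G (punchIn (suc j) ∘ punchIn (suc k)))))
        ≈⟨ sum-cong-≋ (λ j → sum-cong-≋ λ k → term j k) ⟩
      sum (λ j → sum λ k → sgn (toℕ j) * (sgn (toℕ k) *
        (h (suc j) (suc (punchIn j k)) * G (lift 1 (punchIn j ∘ punchIn k)))))
        ≈⟨ pairSum≈0 (λ i j → h (suc i) (suc j)) (λ i j → h-sym (suc i) (suc j))
             (λ σ → G (lift 1 σ)) (λ σ≗τ → G-ext λ { zero → ≡.refl ; (suc x) → ≡.cong suc (σ≗τ x) }) ⟩
      0# ∎
      where
      term : ∀ j k →
        (- 1# * sgn (toℕ j)) * ((- 1# * sgn (toℕ k)) *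
          (h (suc j) (suc (punchIn j k)) * G (punchIn (suc j) ∘ punchIn (suc k))))
        ≈ sgn (toℕ j) * (sgn (toℕ k) *
          (h (suc j) (suc (punchIn j k)) * G (lift 1 (punchIn j ∘ punchIn k))))
      term j k = begin
        (- 1# * sgn (toℕ j)) * ((- 1# * sgn (toℕ k)) * (x * g))
          ≈⟨ solve 5 (λ e s t x g → (e :* s) :* ((e :* t) :* (x :* g)) := (e :* e) :* (s :* (t :* (x :* g))))
               refl (- 1#) (sgn (toℕ j)) (sgn (toℕ k)) x g ⟩
        (- 1# * - 1#) * (sgn (toℕ j) * (sgn (toℕ k) * (x * g)))
          ≈⟨ *-congʳ -1*-1≈1 ⟩
        1# * (sgn (toℕ j) * (sgn (toℕ k) * (x * g)))
          ≈⟨ *-identityˡ _ ⟩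
        sgn (toℕ j) * (sgn (toℕ k) * (x * g))
          ≈⟨ *-congˡ (*-congˡ (*-congˡ (G-ext λ { zero → ≡.refl ; (suc x) → ≡.refl }))) ⟩
        sgn (toℕ j) * (sgn (toℕ k) * (x * G (lift 1 (punchIn j ∘ punchIn k)))) ∎
        where
        x g : Carrier
        x = h (suc j) (suc (punchIn j k))
        g = G (punchIn (suc j) ∘ punchIn (suc k))

  -- The product of the two entries is kept apart from the complementary minor, because `pairSum≈0`
  -- expects this shape.
  det-twoRows : ∀ {n} (a b : Vector Carrier (2 ℕ.+ n)) (C : Vector (Vector Carrier (2 ℕ.+ n)) n) →
                det (a ∷ (b ∷ C)) ≈ sum λ j → sum λ k → sgn (toℕ j) * (sgn (toℕ k) *
                  ((a j * b (punchIn j k)) * det λ x y → C x (punchIn j (punchIn k y))))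
  det-twoRows a b C = sum-cong-≋ λ j →
    let s = sgn (toℕ j)
        g = λ k → det λ x y → C x (punchIn j (punchIn k y))
        t = λ k → sgn (toℕ k) * (b (punchIn j k) * g k)
    in begin
      s * (a j * sum t)                ≈⟨ *-congˡ (*-distribˡ-sum (a j) t) ⟩
      s * sum (λ k → a j * t k)        ≈⟨ *-distribˡ-sum s (λ k → a j * t k) ⟩
      sum (λ k → s * (a j * t k))      ≈⟨ sum-cong-≋ (λ k →
        solve 5 (λ s a t b g → s :* (a :* (t :* (b :* g))) := s :* (t :* ((a :* b) :* g)))
          refl s (a j) (sgn (toℕ k)) (b (punchIn j k)) (g k)) ⟩
      sum (λ k → s * (sgn (toℕ k) * ((a j * b (punchIn j k)) * g k))) ∎

  private
    minor-ext : ∀ {n} (C : Vector (Vector Carrier (2 ℕ.+ n)) n) {σ τ : Fin n → Fin (2 ℕ.+ n)} →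
                σ ≗ τ → det (λ x y → C x (σ y)) ≈ det (λ x y → C x (τ y))
    minor-ext C σ≗τ = det-cong λ x y → reflexive (≡.cong (C x) (σ≗τ y))

  det-equalFirstRows : ∀ {n} (a : Vector Carrier (2 ℕ.+ n)) (C : Vector (Vector Carrier (2 ℕ.+ n)) n) →
                       det (a ∷ (a ∷ C)) ≈ 0#
  det-equalFirstRows a C = trans (det-twoRows a a C)
    (pairSum≈0 (λ i j → a i * a j) (λ i j → *-comm (a i) (a j)) _ (minor-ext C))

  -- The two expansions share their complementary minors, so their sum is a pair sum for the
  -- symmetric function `a i * b j + b i * a j` and vanishes.
  det-swapFirstRows : ∀ {n} (a b : Vector Carrier (2 ℕ.+ n)) (C : Vector (Vector Carrier (2 ℕ.+ n)) n) →
                      det (a ∷ (b ∷ C)) ≈ - 1# * det (b ∷ (a ∷ C))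
  det-swapFirstRows {n} a b C = trans (+-inverseˡ-unique _ _ (begin
    det (a ∷ (b ∷ C)) + det (b ∷ (a ∷ C))
      ≈⟨ +-cong (det-twoRows a b C) (det-twoRows b a C) ⟩
    sum (λ j → sum (T a b j)) + sum (λ j → sum (T b a j))
      ≈⟨ ∑-distrib-+ (λ j → sum (T a b j)) (λ j → sum (T b a j)) ⟨
    sum (λ j → sum (T a b j) + sum (T b a j))
      ≈⟨ sum-cong-≋ (λ j → trans (sym (∑-distrib-+ (T a b j) (T b a j))) (sum-cong-≋ λ k →
           solve 5 (λ s t x y g → s :* (t :* (x :* g)) :+ s :* (t :* (y :* g)) := s :* (t :* ((x :+ y) :* g)))
             refl (sgn (toℕ j)) (sgn (toℕ k)) (a j * b (punchIn j k)) (b j * a (punchIn j k)) (g j k))) ⟩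
    sum (λ j → sum λ k → sgn (toℕ j) * (sgn (toℕ k) *
      ((a j * b (punchIn j k) + b j * a (punchIn j k)) * g j k)))
      ≈⟨ pairSum≈0 (λ i j → a i * b j + b i * a j)
           (λ i j → trans (+-comm _ _) (+-cong (*-comm (b i) (a j)) (*-comm (a i) (b j)))) _ (minor-ext C) ⟩
    0# ∎)) (sym (-1*x≈-x _))
    where
    g : Fin (2 ℕ.+ n) → Fin (1 ℕ.+ n) → Carrier
    g j k = det λ x y → C x (punchIn j (punchIn k y))
    T : (a b : Vector Carrier (2 ℕ.+ n)) → Fin (2 ℕ.+ n) → Fin (1 ℕ.+ n) → Carrier
    T a b j k = sgn (toℕ j) * (sgn (toℕ k) * ((a j * b (punchIn j k)) * g j k))

  -- Mutual induction: a row below the top is first carried to second place, then swapped with the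
  -- top row at the cost of one sign. Carrying it to second place leaves the top row fixed, so after
  -- expansion along that row it is a move to the front in every minor.
  det-moveToFront : ∀ {n} (M : Matrix (suc n)) (k : Fin (suc n)) →
                    det (M k ∷ (M ∘ punchIn k)) ≈ sgn (toℕ k) * det M
  det-moveToSecond : ∀ {n} (a : Vector Carrier (2 ℕ.+ n)) (B : Vector (Vector Carrier (2 ℕ.+ n)) (suc n))
                     (k : Fin (suc n)) →
                     det (a ∷ (B k ∷ (B ∘ punchIn k))) ≈ sgn (toℕ k) * det (a ∷ B)

  det-moveToFront M zero = sym (*-identityˡ (det M))
  det-moveToFront {ℕ.suc n} M (suc k) = begin
    det (M (suc k) ∷ (M ∘ punchIn (suc k)))
      ≈⟨ det-cong {M = M (suc k) ∷ (M ∘ punchIn (suc k))} {N = M (suc k) ∷ (M zero ∷ (tail M ∘ punchIn k))}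
           (λ { zero j → refl ; (suc zero) j → refl ; (suc (suc i)) j → refl }) ⟩
    det (M (suc k) ∷ (M zero ∷ (tail M ∘ punchIn k)))
      ≈⟨ det-swapFirstRows (M (suc k)) (M zero) (tail M ∘ punchIn k) ⟩
    - 1# * det (M zero ∷ (M (suc k) ∷ (tail M ∘ punchIn k)))
      ≈⟨ *-congˡ (det-moveToSecond (M zero) (tail M) k) ⟩
    - 1# * (sgn (toℕ k) * det M)
      ≈⟨ *-assoc (- 1#) (sgn (toℕ k)) (det M) ⟨
    sgn (toℕ (suc k)) * det M ∎

  det-moveToSecond {n} a B k = begin
    sum (λ j → sgn (toℕ j) * (a j * det (λ x y → (B k ∷ (B ∘ punchIn k)) x (punchIn j y))))
      ≈⟨ sum-cong-≋ (λ j → *-congˡ {sgn (toℕ j)} (*-congˡ {a j} (minor j))) ⟩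
    sum (λ j → sgn (toℕ j) * (a j * (sgn (toℕ k) * C j)))
      ≈⟨ sum-cong-≋ (λ j → solve 4 (λ s a t c → s :* (a :* (t :* c)) := t :* (s :* (a :* c)))
                             refl (sgn (toℕ j)) (a j) (sgn (toℕ k)) (C j)) ⟩
    sum (λ j → sgn (toℕ k) * (sgn (toℕ j) * (a j * C j)))
      ≈⟨ *-distribˡ-sum (sgn (toℕ k)) (λ j → sgn (toℕ j) * (a j * C j)) ⟨
    sgn (toℕ k) * det (a ∷ B) ∎
    where
    B′ : Fin (2 ℕ.+ n) → Matrix (suc n)
    B′ j x y = B x (punchIn j y)
    C : Fin (2 ℕ.+ n) → Carrier
    C j = det (B′ j)
    minor : ∀ j → det (λ x y → (B k ∷ (B ∘ punchIn k)) x (punchIn j y)) ≈ sgn (toℕ k) * C j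
    minor j = trans
      (det-cong {M = λ x y → (B k ∷ (B ∘ punchIn k)) x (punchIn j y)} {N = B′ j k ∷ (B′ j ∘ punchIn k)}
        λ { zero y → refl ; (suc x) y → refl })
      (det-moveToFront (B′ j) k)

  -- Row `k` of `B` can be carried up, at the cost of a sign, until it lies directly below its copy.
  det-repeatedRow : ∀ {n} (B : Vector (Vector Carrier (suc n)) n) (k : Fin n) → det (B k ∷ B) ≈ 0#
  det-repeatedRow {ℕ.suc n} B k = sgn*x≈0⇒x≈0 (toℕ k)
    (trans (sym (det-moveToSecond (B k) B k)) (det-equalFirstRows (B k) (B ∘ punchIn k)))

  -- Cramer's rule without division. Put the combination of all rows with weights `u` in place of
  -- row `k`, moved to the front: that row is zero, yet by linearity only the multiple of row `k`
  -- itself contributes, the other rows being repeated.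
  leftKernel-*-det : ∀ {n} (M : Matrix n) (u : Vector Carrier n) →
                     (∀ j → sum (λ i → u i * M i j) ≈ 0#) → ∀ k → u k * det M ≈ 0#
  leftKernel-*-det {ℕ.suc n} M u uM≈0 k = sgn*x≈0⇒x≈0 (toℕ k) (begin
    sgn (toℕ k) * (u k * det M)
      ≈⟨ solve 3 (λ s u d → s :* (u :* d) := u :* (s :* d)) refl (sgn (toℕ k)) (u k) (det M) ⟩
    u k * (sgn (toℕ k) * det M)
      ≈⟨ *-congˡ (det-moveToFront M k) ⟨
    t k
      ≈⟨ +-identityʳ (t k) ⟨
    t k + 0#
      ≈⟨ +-congˡ (sum-zero λ i → trans (*-congˡ {u (punchIn k i)} (det-repeatedRow (M ∘ punchIn k) i))
                                       (zeroʳ (u (punchIn k i)))) ⟨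
    t k + sum (t ∘ punchIn k)
      ≈⟨ sum-remove {i = k} t ⟨
    sum t
      ≈⟨ det-sum-firstRow u M (M ∘ punchIn k) ⟨
    det ((λ j → sum λ i → u i * M i j) ∷ (M ∘ punchIn k))
      ≈⟨ sum-zero (λ j → trans (*-congˡ {sgn (toℕ j)} (trans (*-congʳ {C j} (uM≈0 j)) (zeroˡ (C j))))
                               (zeroʳ (sgn (toℕ j)))) ⟩
    0# ∎)
    where
    t C : Vector Carrier (suc n)
    t i = u i * det (M i ∷ (M ∘ punchIn k))
    C j = det λ x y → M (punchIn k x) (punchIn j y)

  -- The row combination z below, whose coefficients are the signed minors of the
  -- middle rows, vanishes in the middle columns; replacing the first row by z
  -- multiplies det M by its leading coefficient, the central minor.
  desnanotJacobi-symmetric :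
    ∀ {m} (M : Matrix (2 ℕ.+ m)) → (∀ i j → M i j ≈ M j i) →
    det (λ (a b : Fin m) → M (suc (inject₁ a)) (suc (inject₁ b))) * det M
      + det (λ a b → M (suc a) (inject₁ b)) * det (λ a b → M (suc a) (inject₁ b))
    ≈ det (λ a b → M (inject₁ a) (inject₁ b)) * det (λ a b → M (suc a) (suc b))
  desnanotJacobi-symmetric {m} M M-sym = begin
    D * det M + q * q
      ≈⟨ +-congʳ expandCombination ⟨
    det (z ∷ tail M) + q * q
      ≈⟨ +-congʳ expandFirstRow ⟩
    (p * p′ + - (q * q)) + q * q
      ≈⟨ +-assoc _ _ _ ⟩
    p * p′ + (- (q * q) + q * q)
      ≈⟨ +-congˡ (-‿inverseˡ (q * q)) ⟩
    p * p′ + 0#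
      ≈⟨ +-identityʳ _ ⟩
    p * p′ ∎
    where
    B : Vector (Vector Carrier (suc m)) m
    B a b = M (suc (inject₁ a)) (inject₁ b)

    D p p′ q s : Carrier
    D  = det λ (a b : Fin m) → M (suc (inject₁ a)) (suc (inject₁ b))
    p  = det λ a b → M (inject₁ a) (inject₁ b)
    p′ = det λ a b → M (suc a) (suc b)
    q  = det λ a b → M (suc a) (inject₁ b)
    s  = sgn (toℕ (fromℕ m))

    minor w : Vector Carrier (suc m)
    minor j = det λ a b → B a (punchIn j b)
    w j     = sgn (toℕ j) * minor j

    z t : Vector Carrier (2 ℕ.+ m)
    z c = sum λ j → w j * M (inject₁ j) c
    t c = sgn (toℕ c) * (z c * det λ a b → M (suc a) (punchIn c b))

    expandCombination : det (z ∷ tail M) ≈ D * det M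
    expandCombination = begin
      det (z ∷ tail M)
        ≈⟨ det-sum-firstRow w (M ∘ inject₁) (tail M) ⟩
      (1# * D) * det M + sum (λ j → w (suc j) * det (M (suc (inject₁ j)) ∷ tail M))
        ≈⟨ +-cong (*-congʳ (*-identityˡ D)) (sum-zero λ j →
             trans (*-congˡ {w (suc j)} (det-repeatedRow (tail M) (inject₁ j))) (zeroʳ (w (suc j)))) ⟩
      D * det M + 0#
        ≈⟨ +-identityʳ _ ⟩
      D * det M ∎

    -- Symmetry turns the entries of column `c` into entries of row `c`, so that `z c` becomes a
    -- Laplace expansion along a first row. For a middle column this row already occurs in `B`.
    z-column : ∀ c → z c ≈ det ((M c ∘ inject₁) ∷ B)
    z-column c = sum-cong-≋ λ j → begin
      sgn (toℕ j) * minor j * M (inject₁ j) c    ≈⟨ *-congˡ (M-sym (inject₁ j) c) ⟩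
      sgn (toℕ j) * minor j * M c (inject₁ j)    ≈⟨ *-assoc _ _ _ ⟩
      sgn (toℕ j) * (minor j * M c (inject₁ j))  ≈⟨ *-congˡ (*-comm _ _) ⟩
      sgn (toℕ j) * (M c (inject₁ j) * minor j)  ∎

    -- The rows of `B` are those of `N` except its last one, so the matrix from `z-column` is `N`
    -- with its last row moved to the front.
    z-last : z (suc (fromℕ m)) ≈ s * q
    z-last = begin
      z (suc (fromℕ m))
        ≈⟨ z-column (suc (fromℕ m)) ⟩
      det ((M (suc (fromℕ m)) ∘ inject₁) ∷ B)
        ≈⟨ det-cong {M = (M (suc (fromℕ m)) ∘ inject₁) ∷ B} {N = N (fromℕ m) ∷ (N ∘ punchIn (fromℕ m))}
             (λ { zero b → refl ; (suc a) b → reflexive (≡.cong (λ i → N i b) (≡.sym (punchIn-fromℕ a))) }) ⟩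
      det (N (fromℕ m) ∷ (N ∘ punchIn (fromℕ m)))
        ≈⟨ det-moveToFront N (fromℕ m) ⟩
      s * q ∎
      where
      N : Matrix (suc m)
      N a b = M (suc a) (inject₁ b)

    t-middle : ∀ i → t (suc (inject₁ i)) ≈ 0#
    t-middle i = trans
      (*-congˡ {sgn (toℕ (suc (inject₁ i)))} (trans (*-congʳ (trans (z-column (suc (inject₁ i))) (det-repeatedRow B i))) (zeroˡ _)))
      (zeroʳ _)

    -- The last column carries the sign `- s` and `z-last` contributes another `s`; as `s` squares
    -- to one, only the minus sign survives.
    t-last : t (suc (fromℕ m)) ≈ - (q * q)
    t-last = begin
      (- 1# * s) * (z (suc (fromℕ m)) * det (λ a b → M (suc a) (punchIn (suc (fromℕ m)) b)))
        ≈⟨ *-congˡ (*-cong z-last (det-cong {N = λ a b → M (suc a) (inject₁ b)} λ a b → reflexive (≡.cong (M (suc a)) (punchIn-fromℕ b)))) ⟩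
      (- 1# * s) * ((s * q) * q)
        ≈⟨ solve 3 (λ e s q → (e :* s) :* ((s :* q) :* q) := (s :* s) :* (e :* (q :* q))) refl (- 1#) s q ⟩
      (s * s) * (- 1# * (q * q))
        ≈⟨ *-cong (sgn*sgn≈1 (toℕ (fromℕ m))) (-1*x≈-x (q * q)) ⟩
      1# * - (q * q)
        ≈⟨ *-identityˡ _ ⟩
      - (q * q) ∎

    expandFirstRow : det (z ∷ tail M) ≈ p * p′ + - (q * q)
    expandFirstRow = begin
      t zero + sum (t ∘ suc)
        ≈⟨ +-congˡ (sum-init-last (t ∘ suc)) ⟩
      t zero + (sum (t ∘ suc ∘ inject₁) + t (suc (fromℕ m)))
        ≈⟨ +-cong (trans (*-identityˡ _) (*-congʳ (z-column zero))) (+-cong (sum-zero t-middle) t-last) ⟩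
      p * p′ + (0# + - (q * q))
        ≈⟨ +-congˡ (+-identityˡ _) ⟩
      p * p′ + - (q * q) ∎

-- Formal power series: the convolution ring and inverses.

module Series {c ℓ} (A : CommutativeRing c ℓ) where

  open CommutativeRing A hiding (zero)
  open CommutativeMonoidSum +-commutativeMonoid
    using (sum; sum-cong-≋; ∑-distrib-+)
  open SemiringSum semiring using (*-distribˡ-sum)
  open SemiringSolver commutativeSemiring using (solve; _:=_; _:+_; _:*_)
  open SetoidReasoning setoid
  open OverRing A
  open Sum A

  ⊛-congʳ : ∀ {f f′} g → f ≋ f′ → f ⊛ g ≋ f′ ⊛ g
  ⊛-congʳ g f≋f′ n = sum-cong-≋ {suc n} λ i → *-congʳ {g (n ∸ toℕ i)} (f≋f′ (toℕ i))

  -- The definition of the product splits off the term with `f 0`; here the opposite end, the term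
  -- with `g 0`, is split off. Comparing the two gives commutativity.
  ⊛-suc : ∀ f g n → (f ⊛ g) (suc n) ≈ (f ⊛ (g ∘ suc)) n + f (suc n) * g 0
  ⊛-suc f g ℕ.zero    = solve 3 (λ x y z → x :+ (y :+ z) := (x :+ z) :+ y) refl (f 0 * g 1) (f 1 * g 0) 0#
  ⊛-suc f g (ℕ.suc n) = trans (+-congˡ (⊛-suc (f ∘ suc) g n)) (sym (+-assoc _ _ _))

  ⊛-comm : ∀ f g → f ⊛ g ≋ g ⊛ f
  ⊛-comm f g ℕ.zero    = +-congʳ (*-comm (f 0) (g 0))
  ⊛-comm f g (ℕ.suc n) = begin
    f 0 * g (suc n) + ((f ∘ suc) ⊛ g) n  ≈⟨ +-cong (*-comm (f 0) (g (suc n))) (⊛-comm (f ∘ suc) g n) ⟩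
    g (suc n) * f 0 + (g ⊛ (f ∘ suc)) n  ≈⟨ +-comm _ _ ⟩
    (g ⊛ (f ∘ suc)) n + g (suc n) * f 0  ≈⟨ ⊛-suc g f n ⟨
    (g ⊛ f) (suc n)                      ∎

  -- The left factor has the form of a shifted product: `(f ⊛ g) ∘ suc` is `f 0` times the shift of
  -- `g`, plus `(f ∘ suc) ⊛ g`. This drives the induction for associativity.
  ⊛-linearˡ : ∀ x f g h n → ((λ k → x * f k + g k) ⊛ h) n ≈ x * (f ⊛ h) n + (g ⊛ h) n
  ⊛-linearˡ x f g h n = begin
    sum {suc n} (λ i → (x * f (toℕ i) + g (toℕ i)) * h (n ∸ toℕ i))
      ≈⟨ sum-cong-≋ {suc n} (λ i → solve 4 (λ x f g h → (x :* f :+ g) :* h := x :* (f :* h) :+ g :* h)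
           refl x (f (toℕ i)) (g (toℕ i)) (h (n ∸ toℕ i))) ⟩
    sum {suc n} (λ i → x * (f (toℕ i) * h (n ∸ toℕ i)) + g (toℕ i) * h (n ∸ toℕ i))
      ≈⟨ ∑-distrib-+ {suc n} (λ i → x * (f (toℕ i) * h (n ∸ toℕ i))) (λ i → g (toℕ i) * h (n ∸ toℕ i)) ⟩
    sum {suc n} (λ i → x * (f (toℕ i) * h (n ∸ toℕ i))) + (g ⊛ h) n
      ≈⟨ +-congʳ (*-distribˡ-sum {suc n} x (λ i → f (toℕ i) * h (n ∸ toℕ i))) ⟨
    x * (f ⊛ h) n + (g ⊛ h) n ∎

  ⊛-assoc : ∀ f g h → (f ⊛ g) ⊛ h ≋ f ⊛ (g ⊛ h)
  ⊛-assoc f g h ℕ.zero    =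
    +-congʳ (trans (*-congʳ (+-identityʳ _)) (trans (*-assoc (f 0) (g 0) (h 0)) (*-congˡ (sym (+-identityʳ _)))))
  ⊛-assoc f g h (ℕ.suc n) = begin
    (f ⊛ g) 0 * h (suc n) + ((λ k → f 0 * g (suc k) + ((f ∘ suc) ⊛ g) k) ⊛ h) n
      ≈⟨ +-cong (*-congʳ (+-identityʳ _)) (⊛-linearˡ (f 0) (g ∘ suc) ((f ∘ suc) ⊛ g) h n) ⟩
    (f 0 * g 0) * h (suc n) + (f 0 * ((g ∘ suc) ⊛ h) n + (((f ∘ suc) ⊛ g) ⊛ h) n)
      ≈⟨ +-congˡ (+-congˡ (⊛-assoc (f ∘ suc) g h n)) ⟩
    (f 0 * g 0) * h (suc n) + (f 0 * ((g ∘ suc) ⊛ h) n + ((f ∘ suc) ⊛ (g ⊛ h)) n)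
      ≈⟨ solve 5 (λ f g h x y → (f :* g) :* h :+ (f :* x :+ y) := f :* (g :* h :+ x) :+ y)
           refl (f 0) (g 0) (h (suc n)) (((g ∘ suc) ⊛ h) n) (((f ∘ suc) ⊛ (g ⊛ h)) n) ⟩
    (f ⊛ (g ⊛ h)) (suc n) ∎

  zero-⊛ : ∀ {f} → (∀ n → f n ≈ 0#) → ∀ g n → (f ⊛ g) n ≈ 0#
  zero-⊛ f≈0 g n = sum-zero {suc n} λ i → trans (*-congʳ (f≈0 (toℕ i))) (zeroˡ (g (n ∸ toℕ i)))

  ⊛-identityˡ : ∀ f → oneSeries ⊛ f ≋ f
  ⊛-identityˡ f ℕ.zero    = trans (+-identityʳ _) (*-identityˡ (f 0))
  ⊛-identityˡ f (ℕ.suc n) = begin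
    1# * f (suc n) + ((oneSeries ∘ suc) ⊛ f) n  ≈⟨ +-cong (*-identityˡ _) (zero-⊛ {oneSeries ∘ suc} (λ _ → refl) f n) ⟩
    f (suc n) + 0#                              ≈⟨ +-identityʳ _ ⟩
    f (suc n)                                   ∎

  -- The coefficients of the inverse of a series q with constant term 1, in reverse
  -- order: for i ≤ n, entry i of inverseCoeffs q n is the coefficient of t^(n∸i).
  inverseCoeffs : PowerSeries → ℕ → PowerSeries
  inverseCoeffs q ℕ.zero    i         = 1#
  inverseCoeffs q (ℕ.suc n) ℕ.zero    = - sum {suc n} λ i → q (suc (toℕ i)) * inverseCoeffs q n (toℕ i)
  inverseCoeffs q (ℕ.suc n) (ℕ.suc i) = inverseCoeffs q n i

  inverse : PowerSeries → PowerSeries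
  inverse q n = inverseCoeffs q n 0

  inverseCoeffs-reverse : ∀ q {n i} → i ℕ.≤ n → inverseCoeffs q n i ≡ inverse q (n ∸ i)
  inverseCoeffs-reverse q z≤n       = ≡.refl
  inverseCoeffs-reverse q (s≤s i≤n) = inverseCoeffs-reverse q i≤n

  ⊛-inverseʳ : ∀ q → q 0 ≈ 1# → q ⊛ inverse q ≋ oneSeries
  ⊛-inverseʳ q q₀≈1 ℕ.zero    = trans (+-identityʳ _) (trans (*-identityʳ (q 0)) q₀≈1)
  ⊛-inverseʳ q q₀≈1 (ℕ.suc n) = begin
    q 0 * - x + ((q ∘ suc) ⊛ inverse q) n
      ≈⟨ +-cong (trans (*-congʳ q₀≈1) (*-identityˡ (- x)))
           (sum-cong-≋ {suc n} λ i → *-congˡ {q (suc (toℕ i))}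
             (reflexive (≡.sym (inverseCoeffs-reverse q (ℕ.s≤s⁻¹ (toℕ<n i)))))) ⟩
    - x + x
      ≈⟨ -‿inverseˡ x ⟩
    0# ∎
    where
    x : Carrier
    x = sum {suc n} λ i → q (suc (toℕ i)) * inverseCoeffs q n (toℕ i)

  ⊛≋⇒≋÷ : ∀ {f p q} → q 0 ≈ 1# → q ⊛ f ≋ p → f ≋ p ÷ q
  ⊛≋⇒≋÷ {f} {p} {q} q₀≈1 q⊛f≋p = q⁻¹ , q⊛q⁻¹≋1 , λ n → begin
    f n                  ≈⟨ ⊛-identityˡ f n ⟨
    (oneSeries ⊛ f) n    ≈⟨ ⊛-congʳ f q⊛q⁻¹≋1 n ⟨
    ((q ⊛ q⁻¹) ⊛ f) n    ≈⟨ ⊛-congʳ f (⊛-comm q q⁻¹) n ⟩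
    ((q⁻¹ ⊛ q) ⊛ f) n    ≈⟨ ⊛-assoc q⁻¹ q f n ⟩
    (q⁻¹ ⊛ (q ⊛ f)) n    ≈⟨ ⊛-comm q⁻¹ (q ⊛ f) n ⟩
    ((q ⊛ f) ⊛ q⁻¹) n    ≈⟨ ⊛-congʳ q⁻¹ q⊛f≋p n ⟩
    (p ⊛ q⁻¹) n          ∎
    where
    q⁻¹ : PowerSeries
    q⁻¹ = inverse q
    q⊛q⁻¹≋1 : q ⊛ q⁻¹ ≋ oneSeries
    q⊛q⁻¹≋1 = ⊛-inverseʳ q q₀≈1

  polySeries-toℕ : ∀ {m} (a : Vector Carrier m) i → polySeries a (toℕ i) ≡ a i
  polySeries-toℕ a zero    = ≡.refl
  polySeries-toℕ a (suc i) = polySeries-toℕ (tail a) i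

  polySeries-+ : ∀ {m} (a : Vector Carrier m) k → polySeries a (m ℕ.+ k) ≡ 0#
  polySeries-+ {ℕ.zero}  a k = ≡.refl
  polySeries-+ {ℕ.suc m} a k = polySeries-+ (tail a) k

  -- In degree at least `m` the convolution reaches every coefficient of the polynomial and beyond
  -- them meets only zeros, so the sum has a fixed length.
  polySeries-⊛-+ : ∀ {m} (a : Vector Carrier (suc m)) f k →
                   (polySeries a ⊛ f) (m ℕ.+ k) ≈ sum λ i → a i * f ((m ℕ.+ k) ∸ toℕ i)
  polySeries-⊛-+ {ℕ.zero}  a f ℕ.zero    = refl
  polySeries-⊛-+ {ℕ.zero}  a f (ℕ.suc k) = +-congˡ (zero-⊛ {polySeries (tail a)} (λ _ → refl) f k)
  polySeries-⊛-+ {ℕ.suc m} a f k         = +-congˡ (polySeries-⊛-+ (tail a) f k)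

-- Hankel determinants of a sequence.

module Hankel {c ℓ} (A : CommutativeRing c ℓ) (f : ℤ → CommutativeRing.Carrier A) where

  open CommutativeRing A hiding (zero)
  open CommutativeMonoidSum +-commutativeMonoid
    using (sum; sum-cong-≋; sum-init-last; sum-permute; ∑-distrib-+)
  open RingProperties ring using (-1*x≈-x) renaming (x∙y⁻¹≈ε⇒x≈y to x-y≈0⇒x≈y; x≈y⇒x∙y⁻¹≈ε to x≈y⇒x-y≈0)
  open SemiringExp semiring using (^-homo-*)
  open SemiringSum semiring using (*-distribˡ-sum)
  open SemiringSolver commutativeSemiring using (solve; _:=_; _:+_; _:*_)
  open SetoidReasoning setoid
  open OverRing A
  open Determinant A

  H : ∀ m → ℤ → Matrix m
  H m s i j = f (s ℤ.+ + (toℕ i ℕ.+ toℕ j))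

  private
    shift : ∀ s k {x y} → x ≡ k ℕ.+ y → f (s ℤ.+ + x) ≈ f (s ℤ.+ + k ℤ.+ + y)
    shift s k {y = y} ≡.refl = reflexive (≡.cong f (≡.sym (ℤ.+-assoc s (+ k) (+ y))))

  -- Every minor in the Desnanot-Jacobi identity is again a Hankel determinant, and its starting
  -- index grows by the number of leading rows and columns removed. Thus the central minor starts at
  -- s + 2 and the off-diagonal one at s + 1.
  hankel-condensation : ∀ m s →
    det (H m (s ℤ.+ + 2)) * det (H (2 ℕ.+ m) s) + det (H (suc m) (s ℤ.+ + 1)) * det (H (suc m) (s ℤ.+ + 1))
      ≈ det (H (suc m) s) * det (H (suc m) (s ℤ.+ + 2))
  hankel-condensation m s = begin
    det (H m (s ℤ.+ + 2)) * det M + det (H (suc m) (s ℤ.+ + 1)) * det (H (suc m) (s ℤ.+ + 1))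
      ≈⟨ +-cong (*-congʳ centre) (*-cong offDiagonal offDiagonal) ⟨
    det (λ (a b : Fin m) → M (suc (inject₁ a)) (suc (inject₁ b))) * det M
      + det (λ a b → M (suc a) (inject₁ b)) * det (λ a b → M (suc a) (inject₁ b))
      ≈⟨ desnanotJacobi-symmetric M (λ i j → reflexive (≡.cong (λ k → f (s ℤ.+ + k)) (ℕ.+-comm (toℕ i) (toℕ j)))) ⟩
    det (λ a b → M (inject₁ a) (inject₁ b)) * det (λ a b → M (suc a) (suc b))
      ≈⟨ *-cong
           (det-cong {N = H (suc m) s} λ a b →
             reflexive (≡.cong₂ (λ x y → f (s ℤ.+ + (x ℕ.+ y))) (toℕ-inject₁ a) (toℕ-inject₁ b)))
           (det-cong {N = H (suc m) (s ℤ.+ + 2)} λ a b →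
             shift s 2 (≡.cong suc (ℕ.+-suc (toℕ a) (toℕ b)))) ⟩
    det (H (suc m) s) * det (H (suc m) (s ℤ.+ + 2)) ∎
    where
    M : Matrix (2 ℕ.+ m)
    M = H (2 ℕ.+ m) s
    centre : det (λ (a b : Fin m) → M (suc (inject₁ a)) (suc (inject₁ b))) ≈ det (H m (s ℤ.+ + 2))
    centre = det-cong {N = H m (s ℤ.+ + 2)} λ a b → shift s 2
      (≡.cong suc (≡.trans (ℕ.+-suc (toℕ (inject₁ a)) (toℕ (inject₁ b))) (≡.cong₂ (λ x y → suc (x ℕ.+ y)) (toℕ-inject₁ a) (toℕ-inject₁ b))))
    offDiagonal : det (λ a b → M (suc a) (inject₁ b)) ≈ det (H (suc m) (s ℤ.+ + 1))
    offDiagonal = det-cong {N = H (suc m) (s ℤ.+ + 1)} λ a b →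
      shift s 1 (≡.cong (λ y → suc (toℕ a ℕ.+ y)) (toℕ-inject₁ b))

  -- The linear recurrence satisfied by a sequence of Hankel rank r + 1.

  module Recurrence (r : ℕ) (det≈1 : ∀ s → det (H (1 ℕ.+ r) s) ≈ 1#) (det≈0 : ∀ s → det (H (2 ℕ.+ r) s) ≈ 0#) where

    minor v : ℤ → Vector Carrier (2 ℕ.+ r)
    minor s j = det (deleteRowCol (H (2 ℕ.+ r) s) (fromℕ (suc r)) j)
    v s j     = sgn (toℕ j) * minor s j

    -- Deleting the last row and the last column leaves a Hankel window of size r + 1 at the same
    -- start; this is the normalisation c_0 = 1.
    minor-last : ∀ s → minor s (fromℕ (suc r)) ≈ 1#
    minor-last s = trans
      (det-cong {N = H (1 ℕ.+ r) s} λ a b → reflexive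
        (≡.cong₂ (λ x y → f (s ℤ.+ + (x ℕ.+ y))) (toℕ-punchIn a) (toℕ-punchIn b)))
      (det≈1 s)
      where
      toℕ-punchIn : ∀ (a : Fin (suc r)) → toℕ (punchIn (fromℕ (suc r)) a) ≡ toℕ a
      toℕ-punchIn a = ≡.trans (≡.cong toℕ (punchIn-fromℕ a)) (toℕ-inject₁ a)

    -- The sum is the Laplace expansion of the determinant obtained by placing row `i` on top of the
    -- first r + 1 rows. Either row `i` is one of these and is repeated, or it is the last row and
    -- the result is, up to sign, the vanishing determinant of size r + 2.
    v-kernel : ∀ s i → sum (λ j → v s j * H (2 ℕ.+ r) s i j) ≈ 0#
    v-kernel s i = begin
      sum (λ j → v s j * M i j)
        ≈⟨ sum-cong-≋ (λ j → solve 3 (λ s m h → s :* m :* h := s :* (h :* m)) refl (sgn (toℕ j)) (minor s j) (M i j)) ⟩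
      det (M i ∷ (M ∘ punchIn (fromℕ (suc r))))
        ≈⟨ replaceLastRow i ⟩
      0# ∎
      where
      M : Matrix (2 ℕ.+ r)
      M = H (2 ℕ.+ r) s
      replaceLastRow : ∀ i → det (M i ∷ (M ∘ punchIn (fromℕ (suc r)))) ≈ 0#
      replaceLastRow i with view i
      ... | ‵fromℕ = trans (det-moveToFront M (fromℕ (suc r))) (trans (*-congˡ (det≈0 s)) (zeroʳ _))
      ... | ‵inject₁ a = ≡.subst (λ i → det (M i ∷ (M ∘ punchIn (fromℕ (suc r)))) ≈ 0#)
              (punchIn-fromℕ a) (det-repeatedRow (M ∘ punchIn (fromℕ (suc r))) a)

    -- v s and v (s + 1) are both annihilated by the rows 1, …, r+1 of H s and agree in
    -- the last entry, while the square block of the other columns has determinant 1.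
    v-suc : ∀ s j → v s j ≈ v (s ℤ.+ + 1) j
    v-suc s j = x-y≈0⇒x≈y _ _ (u≈0 j)
      where
      G : Matrix (1 ℕ.+ r)
      G = H (1 ℕ.+ r) (s ℤ.+ + 1)

      u : Vector Carrier (2 ℕ.+ r)
      u j = v s j - v (s ℤ.+ + 1) j

      u-last : u (fromℕ (suc r)) ≈ 0#
      u-last = x≈y⇒x-y≈0 (*-congˡ (trans (minor-last s) (sym (minor-last (s ℤ.+ + 1)))))

      g : Fin (1 ℕ.+ r) → Fin (2 ℕ.+ r) → Carrier
      g i j = f (s ℤ.+ + 1 ℤ.+ + (toℕ i ℕ.+ toℕ j))

      u-kernel : ∀ i → sum (λ j → u j * g i j) ≈ 0#
      u-kernel i = begin
        sum (λ j → u j * g i j)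
          ≈⟨ sum-cong-≋ (λ j → distribʳ (g i j) (v s j) (- v s′ j)) ⟩
        sum (λ j → v s j * g i j + - v s′ j * g i j)
          ≈⟨ sum-cong-≋ (λ j → +-cong (*-congˡ {v s j} (sym (shift s 1 {y = toℕ i ℕ.+ toℕ j} ≡.refl)))
               (trans (trans (*-congʳ {g i j} (sym (-1*x≈-x (v s′ j)))) (*-assoc (- 1#) (v s′ j) (g i j)))
                      (*-congˡ (*-congˡ (reflexive (≡.cong (λ x → f (s′ ℤ.+ + (x ℕ.+ toℕ j)))
                        (≡.sym (toℕ-inject₁ i)))))))) ⟩
        sum (λ j → v s j * H (2 ℕ.+ r) s (suc i) j + - 1# * (v s′ j * H (2 ℕ.+ r) s′ (inject₁ i) j))
          ≈⟨ ∑-distrib-+ (λ j → v s j * H (2 ℕ.+ r) s (suc i) j)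
               (λ j → - 1# * (v s′ j * H (2 ℕ.+ r) s′ (inject₁ i) j)) ⟩
        sum (λ j → v s j * H (2 ℕ.+ r) s (suc i) j)
          + sum (λ j → - 1# * (v s′ j * H (2 ℕ.+ r) s′ (inject₁ i) j))
          ≈⟨ +-cong (v-kernel s (suc i)) (trans
               (sym (*-distribˡ-sum (- 1#) λ j → v s′ j * H (2 ℕ.+ r) s′ (inject₁ i) j))
               (trans (*-congˡ (v-kernel s′ (inject₁ i))) (zeroʳ (- 1#)))) ⟩
        0# + 0#
          ≈⟨ +-identityˡ 0# ⟩
        0# ∎
        where
        s′ : ℤ
        s′ = s ℤ.+ + 1

      -- The last column drops out because the last entry of `u` is zero, and symmetry of the Hankel
      -- block turns its right kernel into a left kernel, as `leftKernel-*-det` requires.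
      block-kernel : ∀ i → sum (λ j → u (inject₁ j) * G j i) ≈ 0#
      block-kernel i = begin
        sum (λ j → u (inject₁ j) * G j i)
          ≈⟨ sum-cong-≋ (λ j → *-congˡ {u (inject₁ j)} (reflexive (≡.cong (λ k → f (s ℤ.+ + 1 ℤ.+ + k))
               (≡.trans (ℕ.+-comm (toℕ j) (toℕ i)) (≡.cong (toℕ i ℕ.+_) (≡.sym (toℕ-inject₁ j))))))) ⟩
        sum (λ j → u (inject₁ j) * g i (inject₁ j))
          ≈⟨ +-identityʳ _ ⟨
        sum (λ j → u (inject₁ j) * g i (inject₁ j)) + 0#
          ≈⟨ +-congˡ (trans (*-congʳ u-last) (zeroˡ (g i (fromℕ (suc r))))) ⟨
        sum (λ j → u (inject₁ j) * g i (inject₁ j)) + u (fromℕ (suc r)) * g i (fromℕ (suc r))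
          ≈⟨ sum-init-last (λ j → u j * g i j) ⟨
        sum (λ j → u j * g i j)
          ≈⟨ u-kernel i ⟩
        0# ∎

      u≈0 : ∀ j → u j ≈ 0#
      u≈0 j with view j
      ... | ‵fromℕ     = u-last
      ... | ‵inject₁ i = begin
        u (inject₁ i)          ≈⟨ *-identityʳ _ ⟨
        u (inject₁ i) * 1#     ≈⟨ *-congˡ (det≈1 (s ℤ.+ + 1)) ⟨
        u (inject₁ i) * det G  ≈⟨ leftKernel-*-det G (u ∘ inject₁) block-kernel i ⟩
        0#                     ∎

    v-origin : ∀ s j → v s j ≈ v (+ 0) j
    v-origin (+ ℕ.zero)      j = refl
    v-origin (+ ℕ.suc n)     j = begin
      v (+ suc n) j        ≡⟨ ≡.cong (λ k → v (+ k) j) (ℕ.+-comm 1 n) ⟩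
      v (+ n ℤ.+ + 1) j    ≈⟨ v-suc (+ n) j ⟨
      v (+ n) j            ≈⟨ v-origin (+ n) j ⟩
      v (+ 0) j            ∎
    v-origin -[1+ ℕ.zero ]   j = v-suc -[1+ 0 ] j
    v-origin -[1+ ℕ.suc n ]  j = trans (v-suc -[1+ suc n ] j) (v-origin -[1+ n ] j)

    -- Row zero of the window at `t` is the stretch of the sequence starting at `t`, and `v t` may
    -- be traded for `v s` because neither depends on its window.
    v-recurrence : ∀ s t → sum (λ j → v s j * f (t ℤ.+ + toℕ j)) ≈ 0#
    v-recurrence s t = trans
      (sum-cong-≋ λ j → *-congʳ {f (t ℤ.+ + toℕ j)} (trans (v-origin s j) (sym (v-origin t j))))
      (v-kernel t zero)

    -- This is `v-recurrence` read backwards: substituting r + 1 - i for the summation index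
    -- multiplies all signs by the common factor (-1)^(r+1), which is invertible.
    minor-recurrence : ∀ s k → sum (λ i → sgn (toℕ i) * minor s (opposite i) * f (+ (suc r ℕ.+ k ∸ toℕ i))) ≈ 0#
    minor-recurrence s k = sgn*x≈0⇒x≈0 (suc r) (begin
      sgn (suc r) * sum (λ i → sgn (toℕ i) * minor s (opposite i) * f (+ (suc r ℕ.+ k ∸ toℕ i)))
        ≈⟨ *-distribˡ-sum (sgn (suc r)) (λ i → sgn (toℕ i) * minor s (opposite i) * f (+ (suc r ℕ.+ k ∸ toℕ i))) ⟩
      sum (λ i → sgn (suc r) * (sgn (toℕ i) * minor s (opposite i) * f (+ (suc r ℕ.+ k ∸ toℕ i))))
        ≈⟨ sum-cong-≋ term ⟩
      sum (λ i → v s (opposite i) * f (+ k ℤ.+ + toℕ (opposite i)))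
        ≈⟨ sum-permute (λ j → v s j * f (+ k ℤ.+ + toℕ j)) reverse ⟨
      sum (λ j → v s j * f (+ k ℤ.+ + toℕ j))
        ≈⟨ v-recurrence s (+ k) ⟩
      0# ∎)
      where
      term : ∀ i → sgn (suc r) * (sgn (toℕ i) * minor s (opposite i) * f (+ (suc r ℕ.+ k ∸ toℕ i)))
                 ≈ v s (opposite i) * f (+ k ℤ.+ + toℕ (opposite i))
      term i = begin
        sgn (suc r) * (sgn (toℕ i) * m * f (+ (suc r ℕ.+ k ∸ toℕ i)))
          ≈⟨ *-cong (trans (reflexive (≡.cong sgn (≡.sym o+i≡1+r))) (^-homo-* (- 1#) o (toℕ i)))
               (*-congˡ (reflexive (≡.cong (f ∘ +_) index))) ⟩
        (sgn o * sgn (toℕ i)) * (sgn (toℕ i) * m * y)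
          ≈⟨ solve 4 (λ p q m y → (p :* q) :* (q :* m :* y) := (q :* q) :* (p :* m :* y)) refl (sgn o) (sgn (toℕ i)) m y ⟩
        (sgn (toℕ i) * sgn (toℕ i)) * (sgn o * m * y)
          ≈⟨ *-congʳ (sgn*sgn≈1 (toℕ i)) ⟩
        1# * (sgn o * m * y)
          ≈⟨ *-identityˡ _ ⟩
        sgn o * m * y ∎
        where
        o : ℕ
        o = toℕ (opposite i)
        m y : Carrier
        m = minor s (opposite i)
        y = f (+ k ℤ.+ + o)
        i≤1+r : toℕ i ℕ.≤ suc r
        i≤1+r = ℕ.s≤s⁻¹ (toℕ<n i)
        o+i≡1+r : o ℕ.+ toℕ i ≡ suc r
        o+i≡1+r = ≡.trans (≡.cong (ℕ._+ toℕ i) (opposite-prop i)) (ℕ.m∸n+n≡m i≤1+r)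
        index : suc r ℕ.+ k ∸ toℕ i ≡ k ℕ.+ o
        index = ≡.trans (≡.cong (_∸ toℕ i) (ℕ.+-comm (suc r) k))
          (≡.trans (ℕ.+-∸-assoc k i≤1+r) (≡.cong (k ℕ.+_) (≡.sym (opposite-prop i))))

-- The Q-system as Hankel determinants, and the generating series.

module QSystem {c ℓ₁ ℓ₂} (K : HeytingField c ℓ₁ ℓ₂) (r : ℕ)
               (R : Fin (2 ℕ.+ r) → ℤ → HeytingField.Carrier K) (Q : OverField.IsQSystem K r R) where

  open OverField K
    using (commutativeRing; det; deleteRowCol; sgn; _⊛_; _≋_; _≋_÷_;
           hankel; conserved; numeratorCoeff; generatingSeries; numerator; denominator)
  open OverField.IsQSystem Q
  open HeytingField K using (tight; #⇒invertible)
  open CommutativeRing commutativeRing hiding (zero)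
  open CommutativeMonoidSum +-commutativeMonoid using (sum; sum-cong-≋)
  open RingProperties ring
    using (-0#≈0#; +-cancelʳ; -‿distribʳ-*) renaming (x∙y⁻¹≈ε⇒x≈y to x-y≈0⇒x≈y; x≈y⇒x∙y⁻¹≈ε to x≈y⇒x-y≈0)
  open SemiringExp semiring using (^-homo-*)
  open SemiringSum semiring using (*-distribˡ-sum)
  open SemiringSolver commutativeSemiring using (solve; _:=_; _:*_)
  open SetoidReasoning setoid
  open Determinant commutativeRing
  open Series commutativeRing using (⊛≋⇒≋÷; polySeries-toℕ; polySeries-+; polySeries-⊛-+)
  open Hankel commutativeRing (R (suc zero))

  -- x ≉ 0# does not give x # 0#, but tightness lets us argue by contradiction.
  xy≈0⇒y≈0 : ∀ {x y} → x ≉ 0# → x * y ≈ 0# → y ≈ 0#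
  xy≈0⇒y≈0 {x} {y} x≉0 xy≈0 = proj₁ (tight y 0#) λ y#0 →
    let y⁻¹ , _ , [y-0]y⁻¹≈1 = #⇒invertible y#0 in
    x≉0 (begin
      x                     ≈⟨ *-identityʳ x ⟨
      x * 1#                ≈⟨ *-congˡ [y-0]y⁻¹≈1 ⟨
      x * ((y - 0#) * y⁻¹)  ≈⟨ *-congˡ (*-congʳ (trans (+-congˡ -0#≈0#) (+-identityʳ y))) ⟩
      x * (y * y⁻¹)         ≈⟨ *-assoc x y y⁻¹ ⟨
      x * y * y⁻¹           ≈⟨ *-congʳ xy≈0 ⟩
      0# * y⁻¹              ≈⟨ zeroˡ y⁻¹ ⟩
      0#                    ∎)

  *-cancelˡ-≉0 : ∀ {x y z} → x ≉ 0# → x * y ≈ x * z → y ≈ z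
  *-cancelˡ-≉0 {x} {y} {z} x≉0 xy≈xz = x-y≈0⇒x≈y y z (xy≈0⇒y≈0 x≉0 (begin
    x * (y - z)          ≈⟨ distribˡ x y (- z) ⟩
    x * y + x * - z      ≈⟨ +-congˡ (-‿distribʳ-* x z) ⟨
    x * y - x * z        ≈⟨ x≈y⇒x-y≈0 xy≈xz ⟩
    0#                   ∎))

  -- The equation R_{α,n} = W_{α,n+1-α} with n = s + a - 1. The natural number `a` fixes the matrix
  -- size and carries the induction; for `a` above r + 1 no `α` exists and the condition is vacuous.
  IsHankelDet : ℕ → Set ℓ₁
  IsHankelDet a = ∀ (α : Fin (2 ℕ.+ r)) → toℕ α ≡ a → ∀ s → R α (s ℤ.+ + a ℤ.- + 1) ≈ det (H a s)

  -- At the middle index m + 1 the Q-system relation and Hankel condensation have the same form. All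
  -- terms agree by induction except the one of index m + 2, and its factor R_{m,n} is nonzero and
  -- can be cancelled.
  isHankelDet-step : ∀ m → IsHankelDet m → IsHankelDet (suc m) → IsHankelDet (2 ℕ.+ m)
  isHankelDet-step m ih₀ ih₁ (suc (suc i)) toℕα≡a s = *-cancelˡ-≉0 (nonzero α₋ n) (+-cancelʳ _ _ _ (begin
    R α₋ n * R (suc (suc i)) n + R α n * R α n
      ≈⟨ trans (+-congʳ (*-comm _ _)) (+-comm _ _) ⟩
    R α n * R α n + R (suc (suc i)) n * R α₋ n
      ≈⟨ relation i n ⟨
    R α (n ℤ.+ + 1) * R α (n ℤ.- + 1)
      ≈⟨ *-comm _ _ ⟩
    R α (n ℤ.- + 1) * R α (n ℤ.+ + 1)
      ≈⟨ *-cong (at-α s (solveℤ 2 (λ s m → s ⊕ (con (+ 2) ⊕ m) ⊖ con (+ 1) ⊖ con (+ 1)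
                                          ⊜ s ⊕ (con (+ 1) ⊕ m) ⊖ con (+ 1)) ≡.refl s (+ m)))
               (at-α (s ℤ.+ + 2) (solveℤ 2 (λ s m → s ⊕ (con (+ 2) ⊕ m) ⊖ con (+ 1) ⊕ con (+ 1)
                                          ⊜ s ⊕ con (+ 2) ⊕ (con (+ 1) ⊕ m) ⊖ con (+ 1)) ≡.refl s (+ m))) ⟩
    det (H (suc m) s) * det (H (suc m) (s ℤ.+ + 2))
      ≈⟨ hankel-condensation m s ⟨
    det (H m (s ℤ.+ + 2)) * det (H (2 ℕ.+ m) s) + det (H (suc m) (s ℤ.+ + 1)) * det (H (suc m) (s ℤ.+ + 1))
      ≈⟨ +-cong (*-congʳ at-α₋) (*-cong at-n at-n) ⟨
    R α₋ n * det (H (2 ℕ.+ m) s) + R α n * R α n ∎))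
    where
    open +-*-Solver using (con) renaming (solve to solveℤ; _:+_ to _⊕_; _:-_ to _⊖_; _:=_ to _⊜_)
    α₋ α : Fin (2 ℕ.+ r)
    α₋ = inject₁ (inject₁ i)
    α  = suc (inject₁ i)
    toℕi≡m : toℕ i ≡ m
    toℕi≡m = ℕ.suc-injective (ℕ.suc-injective toℕα≡a)
    n : ℤ
    n = s ℤ.+ + (2 ℕ.+ m) ℤ.- + 1
    at-α : ∀ t {k} → k ≡ t ℤ.+ + suc m ℤ.- + 1 → R α k ≈ det (H (suc m) t)
    at-α t ≡.refl = ih₁ α (≡.cong suc (≡.trans (toℕ-inject₁ i) toℕi≡m)) t
    at-n : R α n ≈ det (H (suc m) (s ℤ.+ + 1))
    at-n = at-α (s ℤ.+ + 1) (solveℤ 2 (λ s m → s ⊕ (con (+ 2) ⊕ m) ⊖ con (+ 1)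
      ⊜ s ⊕ con (+ 1) ⊕ (con (+ 1) ⊕ m) ⊖ con (+ 1)) ≡.refl s (+ m))
    at-α₋ : R α₋ n ≈ det (H m (s ℤ.+ + 2))
    at-α₋ = trans
      (reflexive (≡.cong (R α₋) (solveℤ 2 (λ s m → s ⊕ (con (+ 2) ⊕ m) ⊖ con (+ 1)
        ⊜ s ⊕ con (+ 2) ⊕ m ⊖ con (+ 1)) ≡.refl s (+ m))))
      (ih₀ α₋ (≡.trans (toℕ-inject₁ (inject₁ i)) (≡.trans (toℕ-inject₁ i) toℕi≡m)) (s ℤ.+ + 2))

  R≈det : ∀ a → IsHankelDet a
  R≈det ℕ.zero zero _ s = lowerBoundary _
  R≈det (ℕ.suc ℕ.zero) (suc zero) _ s = begin
    R (suc zero) (s ℤ.+ + 1 ℤ.- + 1)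
      ≡⟨ ≡.cong (R (suc zero)) (+-*-Solver.solve 1 (λ s → s ⊕ con (+ 1) ⊖ con (+ 1) ⊜ s ⊕ con (+ 0)) ≡.refl s) ⟩
    R (suc zero) (s ℤ.+ + 0)
      ≈⟨ trans (+-identityʳ _) (trans (*-identityˡ _) (*-identityʳ _)) ⟨
    det (H 1 s) ∎
    where open +-*-Solver using (con) renaming (_:+_ to _⊕_; _:-_ to _⊖_; _:=_ to _⊜_)
  R≈det (ℕ.suc (ℕ.suc m)) = isHankelDet-step m (R≈det m) (R≈det (suc m))

  det≈1 : ∀ s → det (H (1 ℕ.+ r) s) ≈ 1#
  det≈1 s = trans (sym (R≈det (1 ℕ.+ r) (fromℕ (suc r)) (toℕ-fromℕ (suc r)) s)) (upperBoundary _)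

  -- Since all determinants of size r + 1 are one, condensation reads W_r W_{r+2} + 1 = 1. The
  -- factor W_r is a value of R at index r, hence nonzero.
  det≈0 : ∀ s → det (H (2 ℕ.+ r) s) ≈ 0#
  det≈0 s = xy≈0⇒y≈0 det≉0 (+-cancelʳ _ _ _ (begin
    det (H r (s ℤ.+ + 2)) * det (H (2 ℕ.+ r) s) + det (H (1 ℕ.+ r) (s ℤ.+ + 1)) * det (H (1 ℕ.+ r) (s ℤ.+ + 1))
      ≈⟨ hankel-condensation r s ⟩
    det (H (1 ℕ.+ r) s) * det (H (1 ℕ.+ r) (s ℤ.+ + 2))
      ≈⟨ *-cong (trans (det≈1 s) (sym (det≈1 (s ℤ.+ + 1)))) (trans (det≈1 (s ℤ.+ + 2)) (sym (det≈1 (s ℤ.+ + 1)))) ⟩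
    det (H (1 ℕ.+ r) (s ℤ.+ + 1)) * det (H (1 ℕ.+ r) (s ℤ.+ + 1))
      ≈⟨ +-identityˡ _ ⟨
    0# + det (H (1 ℕ.+ r) (s ℤ.+ + 1)) * det (H (1 ℕ.+ r) (s ℤ.+ + 1)) ∎))
    where
    det≉0 : det (H r (s ℤ.+ + 2)) ≉ 0#
    det≉0 eq = nonzero (inject₁ (fromℕ r)) _
      (trans (R≈det r (inject₁ (fromℕ r)) (≡.trans (toℕ-inject₁ (fromℕ r)) (toℕ-fromℕ r)) (s ℤ.+ + 2)) eq)

  open Recurrence r det≈1 det≈0

  -- Counting rows and columns from one contributes 2 to the index, so the top left entry of
  -- `hankel` sits at n + 2 - r - 3 = n - r - 1.
  conserved≈minor : ∀ n k → conserved r R n k ≈ minor (n ℤ.- + r ℤ.- + 1) (opposite k)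
  conserved≈minor n k = det-cong
    {M = deleteRowCol (hankel r R n) (fromℕ (suc r)) (opposite k)}
    {N = deleteRowCol (H (2 ℕ.+ r) (n ℤ.- + r ℤ.- + 1)) (fromℕ (suc r)) (opposite k)}
    λ a b → reflexive (≡.cong (R (suc zero))
      (solveℤ 4 (λ n r i j → n ⊕ (con (+ 1) ⊕ i) ⊕ (con (+ 1) ⊕ j) ⊖ r ⊖ con (+ 3) ⊜ n ⊖ r ⊖ con (+ 1) ⊕ (i ⊕ j))
        ≡.refl n (+ r) (+ toℕ (punchIn (fromℕ (suc r)) a)) (+ toℕ (punchIn (opposite k) b))))
    where open +-*-Solver using (con) renaming (solve to solveℤ; _:+_ to _⊕_; _:-_ to _⊖_; _:=_ to _⊜_)

  conserved-zero : ∀ n → conserved r R n zero ≈ 1#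
  conserved-zero n = trans (conserved≈minor n zero) (minor-last (n ℤ.- + r ℤ.- + 1))

  private
    F : ℕ → Carrier
    F = generatingSeries r R

  -- In degree j ≤ r the convolution matches the definition of d_j term by term, since (-1)^i =
  -- (-1)^j (-1)^(j-i).
  denominator⊛series-low : ∀ n j → (denominator r R n ⊛ F) (toℕ j) ≈ numerator r R n (toℕ j)
  denominator⊛series-low n j = begin
    sum {suc (toℕ j)} (λ i → denominator r R n (toℕ i) * F (toℕ j ∸ toℕ i))
      ≈⟨ sum-cong-≋ {suc (toℕ j)} term ⟩
    sum {suc (toℕ j)} (λ i → sgn (toℕ j) * t i)
      ≈⟨ *-distribˡ-sum {suc (toℕ j)} (sgn (toℕ j)) t ⟨
    sgn (toℕ j) * numeratorCoeff r R n j
      ≡⟨ polySeries-toℕ (λ j → sgn (toℕ j) * numeratorCoeff r R n j) j ⟨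
    numerator r R n (toℕ j) ∎
    where
    q : ℕ → Carrier
    q = denominator r R n
    t : Fin (suc (toℕ j)) → Carrier
    t i = sgn (toℕ j ∸ toℕ i) * conserved r R n (inject {i = suc j} i) * F (toℕ j ∸ toℕ i)
    term : ∀ i → q (toℕ i) * F (toℕ j ∸ toℕ i) ≈ sgn (toℕ j) * t i
    term i = begin
      -- `polySeries-toℕ` reads off a coefficient at an index of the full range 0, ..., r + 1, hence
      -- the detour through `i′`.
      q (toℕ i) * y
        ≡⟨ ≡.cong (λ k → q k * y) (toℕ-inject {i = suc j} i) ⟨
      q (toℕ i′) * y
        ≡⟨ ≡.cong (_* y) (polySeries-toℕ (λ j → sgn (toℕ j) * conserved r R n j) i′) ⟩
      sgn (toℕ i′) * x * y
        ≡⟨ ≡.cong (λ k → sgn k * x * y) (toℕ-inject {i = suc j} i) ⟩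
      sgn (toℕ i) * x * y
        ≈⟨ *-congʳ (*-congʳ (sgn*sgn[∸]≈sgn (ℕ.s≤s⁻¹ (toℕ<n i)))) ⟨
      sgn (toℕ j) * sgn (toℕ j ∸ toℕ i) * x * y
        ≈⟨ solve 4 (λ s d x y → s :* d :* x :* y := s :* (d :* x :* y)) refl (sgn (toℕ j)) (sgn (toℕ j ∸ toℕ i)) x y ⟩
      sgn (toℕ j) * t i ∎
      where
      i′ : Fin (2 ℕ.+ r)
      i′ = inject {i = suc j} i
      x y : Carrier
      x = conserved r R n i′
      y = F (toℕ j ∸ toℕ i)

  denominator⊛series-high : ∀ n k → (denominator r R n ⊛ F) (suc r ℕ.+ k) ≈ numerator r R n (suc r ℕ.+ k)
  denominator⊛series-high n k = begin
    (denominator r R n ⊛ F) (suc r ℕ.+ k)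
      ≈⟨ polySeries-⊛-+ (λ j → sgn (toℕ j) * conserved r R n j) F k ⟩
    sum (λ i → sgn (toℕ i) * conserved r R n i * F (suc r ℕ.+ k ∸ toℕ i))
      ≈⟨ sum-cong-≋ (λ i → *-congʳ {F (suc r ℕ.+ k ∸ toℕ i)}
           (*-congˡ {sgn (toℕ i)} (conserved≈minor n i))) ⟩
    sum (λ i → sgn (toℕ i) * minor (n ℤ.- + r ℤ.- + 1) (opposite i) * F (suc r ℕ.+ k ∸ toℕ i))
      ≈⟨ minor-recurrence (n ℤ.- + r ℤ.- + 1) k ⟩
    0#
      ≡⟨ polySeries-+ (λ j → sgn (toℕ j) * numeratorCoeff r R n j) k ⟨
    numerator r R n (suc r ℕ.+ k) ∎

  denominator⊛series : ∀ n → denominator r R n ⊛ F ≋ numerator r R n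
  denominator⊛series n m with m ℕ.<? suc r
  ... | yes m≤r = ≡.subst (λ k → (denominator r R n ⊛ F) k ≈ numerator r R n k)
                    (toℕ-fromℕ< m≤r) (denominator⊛series-low n (fromℕ< m≤r))
  ... | no m≰r  = ≡.subst (λ k → (denominator r R n ⊛ F) k ≈ numerator r R n k)
                    (ℕ.m+[n∸m]≡n (ℕ.≮⇒≥ m≰r)) (denominator⊛series-high n (m ∸ suc r))

  series≋numerator÷denominator : ∀ n → generatingSeries r R ≋ numerator r R n ÷ denominator r R n
  series≋numerator÷denominator n =
    -- The constant term of the denominator is (-1)^0 c_0 = 1, which makes it a unit.
    ⊛≋⇒≋÷ {q = denominator r R n} (trans (*-identityˡ _) (conserved-zero n)) (denominator⊛series n)

open import Data.Nat.Base using (_+_)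

mainTheorem7 : ∀ {c ℓ₁ ℓ₂} (K : HeytingField c ℓ₁ ℓ₂) (r : ℕ) → 1 ≤ r →
    let module F = OverField K in
    (ι : ℚ → F.Carrier) (R : Fin (2 + r) → ℤ → F.Carrier) →
    F.IsRationalFunctionField ι (F.initialValues r R) →
    F.IsQSystem r R →
    ∀ (n : ℤ) → F.generatingSeries r R F.≋ F.numerator r R n ÷ F.denominator r R n
mainTheorem7 K r _ _ R _ Q n = QSystem.series≋numerator÷denominator K r R Q n
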